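{- Let $d\in\mathbb N\cup\{\infty\}$, let $n\leq 4$ and let $w\in\mathbb Z^{V_d}$ be a valid outcome whose positive support has size $n+1$. Then $\deg(w)\leq 2n-1$.
   Context: For $d\in\mathbb N\cup\{\infty\}$ let $V_d=\{(i,j)\in\mathbb Z_{\geq0}^2\mid i+j\leq d\}$ and $\deg(i,j)=i+j$. A chip configuration is a finitely supported vector $w=(w_{i,j})\in\mathbb Z^{V_d}$. A splitting move at $p\in V_{d-1}$ decreases $w_p$ by $1$ and increases $w_{p+(1,0)}$ and $w_{p+(0,1)}$ by $1$ each; an unsplitting move at $p$ is its inverse. An outcome is a configuration obtainable from the zero configuration by a finite sequence of splitting and unsplitting moves. The positive support is $\mathrm{supp}^+(w)=\{(i,j)\mid w_{i,j}>0\}$, the negative support $\mathrm{supp}^-(w)=\{(i,j)\mid w_{i,j}<0\}$, the support is their union, and $\deg(w)=\max\{\deg(i,j)\mid (i,j)\in\mathrm{supp}(w)\}$. The configuration $w$ is valid if $\mathrm{supp}^-(w)\subseteq\{(0,0)\}$. -}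

module Defs where

open import Data.Nat using (ℕ; zero; suc; _+_; _≤_; _<_)
open import Data.Integer as ℤ using (ℤ; 0ℤ; 1ℤ; -1ℤ)
open import Data.Product using (_×_; _,_; Σ; ∃)
open import Data.Bool using (Bool; true; false; if_then_else_)
open import Data.List using (List; []; _∷_; length)
open import Data.List.Relation.Unary.All using (All)
open import Data.List.Relation.Unary.Unique.Propositional using (Unique)
open import Data.List.Membership.Propositional using (_∈_)
open import Relation.Nullary using (¬_)
open import Relation.Nullary.Decidable using (⌊_⌋)
open import Relation.Binary.PropositionalEquality using (_≡_)
open import Function.Bundles using (_⇔_)

data ℕ∞ : Set where
  fin : ℕ → ℕ∞
  ∞   : ℕ∞

Point : Set
Point = ℕ × ℕ

deg : Point → ℕ
deg (i , j) = i + j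

InV : ℕ∞ → Point → Set
InV (fin d) p = deg p ≤ d
InV ∞       p = Data.Unit.⊤ where import Data.Unit

-- p ∈ V_{d-1}  (V_{-1} = ∅ when d = 0; V_{∞-1} = V_∞)
InVpred : ℕ∞ → Point → Set
InVpred (fin d) p = suc (deg p) ≤ d
InVpred ∞       p = Data.Unit.⊤ where import Data.Unit

-- chip configurations on the quadrant (zero outside V_d for outcomes)
Config : Set
Config = Point → ℤ

zeroConfig : Config
zeroConfig _ = 0ℤ

_≟P_ : Point → Point → Bool
(a , b) ≟P (c , e) = ⌊ a Data.Nat.≟ c ⌋ Data.Bool.∧ ⌊ b Data.Nat.≟ e ⌋
  where import Data.Nat ; import Data.Bool

ind : Point → Point → ℤ
ind p q = if p ≟P q then 1ℤ else 0ℤ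

splitDelta : Point → Config
splitDelta (a , b) q = ((ℤ.- ind (a , b) q) ℤ.+ ind (suc a , b) q) ℤ.+ ind (a , suc b) q

-- a move: (true , p) = splitting at p, (false , p) = unsplitting at p
Move : Set
Move = Bool × Point

applyMove : Move → Config → Config
applyMove (true  , p) w q = w q ℤ.+ splitDelta p q
applyMove (false , p) w q = w q ℤ.- splitDelta p q

applyMoves : List Move → Config → Config
applyMoves []       w = w
applyMoves (m ∷ ms) w = applyMoves ms (applyMove m w)

LegalMove : ℕ∞ → Move → Set
LegalMove d (_ , p) = InVpred d p

Outcome : ℕ∞ → Config → Set
Outcome d w = Σ (List Move) λ ms → All (LegalMove d) ms × (∀ q → applyMoves ms zeroConfig q ≡ w q)

Valid : Config → Set
Valid w = ∀ q → w q ℤ.< 0ℤ → q ≡ (0 , 0)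

PosSuppSize : Config → ℕ → Set
PosSuppSize w k = Σ (List Point) λ L → Unique L × (∀ q → (0ℤ ℤ.< w q) ⇔ (q ∈ L)) × length L ≡ k

DegLE : Config → ℤ → Set
DegLE w m = ∀ q → ¬ (w q ≡ 0ℤ) → ℤ.+ (deg q) ℤ.≤ m

{-# OPTIONS --safe #-}

-- Let f p be the net number of splittings at p, so that w p + f p is the sum of
-- f over the left and lower neighbours of p. A point where w > 0 is called a
-- sink. If w has degree D ≥ 1, then f is positive at some (a , b) with
-- a + b = D - 1, and tracing positivity backwards gives a lattice path of
-- positive values from the origin to (a , b). It suffices to find 1 + ⌈b/2⌉ sinks to
-- the right of the path (in rows 0..b) and, by symmetry, 1 + ⌈a/2⌉ above it, since
-- together these are at least (D + 3)/2.
--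
-- To the right of the path, mark every point as negative or not: by the sign of
-- f if f ≠ 0, by copying the left neighbour at a zero of f, except that beyond
-- the last nonzero value of row y all points are marked iff y is odd. Then a
-- marked point is a sink or has a marked left or lower neighbour, and an
-- unmarked point has an unmarked one. Hence, from one column to the next, the
-- number of maximal runs of marked points grows by at most the number of marked
-- sinks in the column. The column x = 0 has no run, a far column has ⌈b/2⌉. One
-- more sink, unmarked, lies at the end of row 0.
module Submission where

open import Defs
open import Data.Nat using (ℕ; zero; suc; _+_; _≤_; _<_; _*_; z≤n; s≤s; z<s; _≤?_; _<?_; _∸_)
import Data.Nat.Properties as ℕ
open import Data.Nat.Tactic.RingSolver using (solve-∀)
open import Data.Integer as ℤ using (ℤ; +_; _-_; 0ℤ; 1ℤ)
import Data.Integer.Properties as ℤ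
import Data.Integer.Tactic.RingSolver as ℤ-Solver
open import Data.Bool using (Bool; true; false; not; _∧_; if_then_else_)
open import Data.Bool.Properties using (∧-zeroʳ)
open import Data.List using (List; []; _∷_; _++_; length; map)
open import Data.List.Properties using (length-++; length-map)
open import Data.List.Membership.Propositional using (_∈_)
open import Data.List.Membership.Propositional.Properties using (∈-∃++; ∈-++⁻; ∈-++⁺ˡ; ∈-++⁺ʳ; ∈-map⁻)
open import Data.List.Relation.Unary.All as All using (All; []; _∷_)
import Data.List.Relation.Unary.All.Properties as All
open import Data.List.Relation.Unary.AllPairs using ([]; _∷_)
open import Data.List.Relation.Unary.Any using (here; there)
open import Data.List.Relation.Unary.Unique.Propositional using (Unique)
import Data.List.Relation.Unary.Unique.Propositional.Properties as Unique
open import Data.Product using (_×_; _,_; ∃-syntax; proj₁; proj₂; swap)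
open import Data.Sum as Sum using (_⊎_; inj₁; inj₂)
open import Data.Empty using (⊥; ⊥-elim)
open import Function using (_∘_; flip)
open import Function.Bundles using (Equivalence)
open import Relation.Binary.Definitions using (Tri; tri<; tri≈; tri>)
open import Relation.Binary.PropositionalEquality
open import Relation.Nullary.Decidable using (⌊_⌋; isYes≗does)
open import Relation.Nullary using (¬_; Dec; yes; no; contradiction)

-- Counting in lists and signs of sums

Unique-⊆⇒length≤ : {A : Set} {xs ys : List A} → Unique xs → (∀ {x} → x ∈ xs → x ∈ ys) → length xs ≤ length ys
Unique-⊆⇒length≤ [] _ = z≤n
Unique-⊆⇒length≤ {xs = x ∷ xs} (x∉xs ∷ xs!) xs⊆ys with ∈-∃++ (xs⊆ys (here refl))
... | us , vs , refl = begin
  suc (length xs)             ≤⟨ s≤s (Unique-⊆⇒length≤ xs! xs⊆us++vs) ⟩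
  suc (length (us ++ vs))     ≡⟨ cong suc (length-++ us) ⟩
  suc (length us + length vs) ≡⟨ ℕ.+-suc _ _ ⟨
  length us + suc (length vs) ≡⟨ length-++ us ⟨
  length (us ++ x ∷ vs)       ∎
  where
  open ℕ.≤-Reasoning
  xs⊆us++vs : ∀ {z} → z ∈ xs → z ∈ us ++ vs
  xs⊆us++vs z∈xs with ∈-++⁻ us (xs⊆ys (there z∈xs))
  ... | inj₁ z∈us         = ∈-++⁺ˡ z∈us
  ... | inj₂ (here refl)  = contradiction refl (All.lookup x∉xs z∈xs)
  ... | inj₂ (there z∈vs) = ∈-++⁺ʳ us z∈vs

0<i+j⇒0<i⊎0<j : ∀ i j → 0ℤ ℤ.< i ℤ.+ j → 0ℤ ℤ.< i ⊎ 0ℤ ℤ.< j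
0<i+j⇒0<i⊎0<j i j 0<i+j with 0ℤ ℤ.<? i | 0ℤ ℤ.<? j
... | yes 0<i | _       = inj₁ 0<i
... | no _    | yes 0<j = inj₂ 0<j
... | no 0≮i  | no 0≮j  = contradiction 0<i+j (ℤ.≤⇒≯ (ℤ.+-mono-≤ (ℤ.≮⇒≥ 0≮i) (ℤ.≮⇒≥ 0≮j)))

i+j<0⇒i<0⊎j<0 : ∀ i j → i ℤ.+ j ℤ.< 0ℤ → i ℤ.< 0ℤ ⊎ j ℤ.< 0ℤ
i+j<0⇒i<0⊎j<0 i j i+j<0 with i ℤ.<? 0ℤ | j ℤ.<? 0ℤ
... | yes i<0 | _       = inj₁ i<0
... | no _    | yes j<0 = inj₂ j<0
... | no i≮0  | no j≮0  = contradiction i+j<0 (ℤ.≤⇒≯ (ℤ.+-mono-≤ (ℤ.≮⇒≥ i≮0) (ℤ.≮⇒≥ j≮0)))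

-- Runs in Boolean words

odd : ℕ → Bool
odd zero    = false
odd (suc n) = not (odd n)

starts : Bool → Bool → ℕ
starts false true = 1
starts _     _    = 0

starts-refl : ∀ a → starts a a ≡ 0
starts-refl false = refl
starts-refl true  = refl

starts-triangle : ∀ a b c → starts a c ≤ starts a b + starts b c
starts-triangle false false c     = ℕ.≤-refl
starts-triangle false true  false = z≤n
starts-triangle false true  true  = ℕ.≤-refl
starts-triangle true  b     c     = z≤n

-- A start leaves the letter at `true`, so an adjacent second start is impossible.
starts-path≤1 : ∀ a b c → starts a b + starts b c ≤ 1
starts-path≤1 false false false = z≤n
starts-path≤1 false false true  = ℕ.≤-refl
starts-path≤1 false true  c     = ℕ.≤-refl
starts-path≤1 true  false false = z≤n
starts-path≤1 true  false true  = ℕ.≤-refl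
starts-path≤1 true  true  c     = z≤n

-- The number of maximal runs of true in c 0, ..., c y, provided c 0 is false.
runs : (ℕ → Bool) → ℕ → ℕ
runs c zero    = 0
runs c (suc y) = runs c y + starts (c y) (c (suc y))

-- Every odd position is a run of its own. The exact count needs a correction for the parity of `y`,
-- which is what makes the induction go through.
runs-odd : ∀ y → y ≤ 2 * runs odd y
runs-odd y = ℕ.≤-trans (ℕ.m≤m+n y _) (ℕ.≤-reflexive (exact y))
  where
  bit : Bool → ℕ
  bit false = 0
  bit true  = 1
  exact : ∀ y → y + bit (odd y) ≡ 2 * runs odd y
  exact zero = refl
  exact (suc y) with odd y | exact y
  ... | false | eq = trans (step y) (trans (cong (suc ∘ suc) eq) (sym (step′ (runs odd y))))
    where
    step : ∀ y → suc y + 1 ≡ 2 + (y + 0)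
    step = solve-∀
    step′ : ∀ z → 2 * (z + 1) ≡ 2 + 2 * z
    step′ = solve-∀
  ... | true  | eq = trans (step y) (trans eq (sym (step′ (runs odd y))))
    where
    step : ∀ y → suc y + 0 ≡ y + 1
    step = solve-∀
    step′ : ∀ z → 2 * (z + 0) ≡ 2 * z
    step′ = solve-∀

runs-cong : ∀ {c c′ : ℕ → Bool} y → (∀ i → i ≤ y → c i ≡ c′ i) → runs c y ≡ runs c′ y
runs-cong zero    _  = refl
runs-cong (suc y) eq = cong₂ _+_ (runs-cong y λ i i≤y → eq i (ℕ.m≤n⇒m≤1+n i≤y))
                                 (cong₂ starts (eq y (ℕ.n≤1+n y)) (eq (suc y) ℕ.≤-refl))

runs-false : ∀ y → runs (λ _ → false) y ≡ 0
runs-false zero    = refl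
runs-false (suc y) = trans (ℕ.+-identityʳ _) (runs-false y)

-- The summand starts (m y) (l y) records that l has already started a run which
-- m may still join.
runs-next-column : ∀ (S : ℕ → Set) (l m : ℕ → Bool) (b : ℕ) → l 0 ≡ false → m 0 ≡ false →
  (∀ y → suc y ≤ b → (m (suc y) ≡ true × S (suc y)) ⊎ m (suc y) ≡ l (suc y) ⊎ m (suc y) ≡ m y) →
  ∀ y → y ≤ b → ∃[ K ] Unique K × All (λ i → (0 < i × i ≤ y) × m i ≡ true × S i) K ×
    runs m y + starts (m y) (l y) ≤ runs l y + length K
runs-next-column S l m b l0 m0 local zero _ rewrite l0 | m0 = [] , [] , [] , z≤n
runs-next-column S l m b l0 m0 local (suc y) y<b
  with runs-next-column S l m b l0 m0 local y (ℕ.<⇒≤ y<b)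
... | K , K! , K-ok , bound = extend (local y y<b)
  where
  Result : Set
  Result = ∃[ K ] Unique K × All (λ i → (0 < i × i ≤ suc y) × m i ≡ true × S i) K ×
    runs m (suc y) + starts (m (suc y)) (l (suc y)) ≤ runs l (suc y) + length K

  weaken : ∀ {i} → (0 < i × i ≤ y) × m i ≡ true × S i → (0 < i × i ≤ suc y) × m i ≡ true × S i
  weaken ((0<i , i≤y) , rest) = (0<i , ℕ.m≤n⇒m≤1+n i≤y) , rest

  open ℕ.≤-Reasoning

  s₁ s₂ s₃ s₄ : ℕ
  s₁ = starts (m y) (m (suc y))
  s₂ = starts (m (suc y)) (l (suc y))
  s₃ = starts (m y) (l y)
  s₄ = starts (l y) (l (suc y))

  regroup : ∀ δ → s₁ + s₂ ≤ s₃ + s₄ + δ →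
    runs m (suc y) + s₂ ≤ runs l (suc y) + (δ + length K)
  regroup δ p = begin
    (runs m y + s₁) + s₂                ≡⟨ ℕ.+-assoc (runs m y) s₁ s₂ ⟩
    runs m y + (s₁ + s₂)                ≤⟨ ℕ.+-monoʳ-≤ (runs m y) p ⟩
    runs m y + (s₃ + s₄ + δ)            ≡⟨ e₁ (runs m y) s₃ s₄ δ ⟩
    (runs m y + s₃) + (s₄ + δ)          ≤⟨ ℕ.+-monoˡ-≤ _ bound ⟩
    (runs l y + length K) + (s₄ + δ)    ≡⟨ e₂ (runs l y) (length K) s₄ δ ⟩
    (runs l y + s₄) + (δ + length K)    ∎
    where
    e₁ : ∀ A s₃ s₄ δ → A + (s₃ + s₄ + δ) ≡ (A + s₃) + (s₄ + δ)
    e₁ = solve-∀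
    e₂ : ∀ R k s₄ δ → (R + k) + (s₄ + δ) ≡ (R + s₄) + (δ + k)
    e₂ = solve-∀

  -- Without a new sink, the two starts through `m (suc y)` amount to a single one from `m y` to
  -- `l (suc y)`, and the triangle inequality reroutes it through `l y`.
  keep : s₁ + s₂ ≡ starts (m y) (l (suc y)) → Result
  keep eq = K , K! , All.map weaken K-ok , regroup 0 (begin
    s₁ + s₂                    ≡⟨ eq ⟩
    starts (m y) (l (suc y))   ≤⟨ starts-triangle (m y) (l y) (l (suc y)) ⟩
    s₃ + s₄                    ≡⟨ ℕ.+-identityʳ _ ⟨
    s₃ + s₄ + 0                ∎)

  extend : (m (suc y) ≡ true × S (suc y)) ⊎ m (suc y) ≡ l (suc y) ⊎ m (suc y) ≡ m y → Result
  extend (inj₁ (marked , sink)) = suc y ∷ K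
    , All.map (λ { ((_ , i≤y) , _) refl → ℕ.<-irrefl refl i≤y }) K-ok ∷ K!
    , ((z<s , ℕ.≤-refl) , marked , sink) ∷ All.map weaken K-ok
    -- The new sink pays for the at most one start along `m y`, `m (suc y)`, `l (suc y)`.
    , regroup 1 (ℕ.≤-trans (starts-path≤1 (m y) (m (suc y)) (l (suc y))) (ℕ.m≤n+m 1 _))
  extend (inj₂ (inj₁ m≡l)) = keep (trans
    (cong (λ c → starts (m y) c + starts c (l (suc y))) m≡l)
    (trans (cong (λ z → starts (m y) (l (suc y)) + z) (starts-refl (l (suc y)))) (ℕ.+-identityʳ _)))
  extend (inj₂ (inj₂ m≡m)) = keep
    (trans (cong (λ c → starts (m y) c + starts c (l (suc y))) m≡m)
           (cong (_+ starts (m y) (l (suc y))) (starts-refl (m y))))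

-- Induction on the column: column 0 has no run, and each later column contributes its own marked
-- sinks. These are new because all earlier ones have smaller abscissa.
runs-columns : ∀ (S : ℕ → ℕ → Set) (c : ℕ → ℕ → Bool) (b : ℕ) →
  (∀ y → c 0 y ≡ false) → (∀ x → c x 0 ≡ false) →
  (∀ x y → suc y ≤ b → (c (suc x) (suc y) ≡ true × S (suc x) (suc y)) ⊎
    c (suc x) (suc y) ≡ c x (suc y) ⊎ c (suc x) (suc y) ≡ c (suc x) y) →
  ∀ x → ∃[ K ] Unique K × runs (c x) b ≤ length K ×
    All (λ (i , j) → i ≤ x × (0 < j × j ≤ b) × c i j ≡ true × S i j) K
runs-columns S c b col0 row0 local zero =
  [] , [] , ℕ.≤-reflexive (trans (runs-cong b λ y _ → col0 y) (runs-false b)) , []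
runs-columns S c b col0 row0 local (suc x)
  with runs-columns S c b col0 row0 local x
     | runs-next-column (S (suc x)) (c x) (c (suc x)) b (row0 x) (row0 (suc x)) (local x) b ℕ.≤-refl
... | K , K! , runs≤ , K-ok | J , J! , J-ok , step =
    column ++ K
  , Unique.++⁺ (Unique.map⁺ (cong proj₂) J!) K! disjoint
  , (begin
      runs (c (suc x)) b                                ≤⟨ ℕ.m≤m+n _ _ ⟩
      runs (c (suc x)) b + starts (c (suc x) b) (c x b) ≤⟨ step ⟩
      runs (c x) b + length J                           ≤⟨ ℕ.+-monoˡ-≤ _ runs≤ ⟩
      length K + length J                               ≡⟨ ℕ.+-comm (length K) _ ⟩
      length J + length K                               ≡⟨ cong (_+ length K) (length-column) ⟨
      length column + length K                          ≡⟨ length-++ column ⟨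
      length (column ++ K)                              ∎)
  , All.++⁺ (All.map⁺ (All.map (ℕ.≤-refl ,_) J-ok)) (All.map (λ (i≤x , rest) → ℕ.m≤n⇒m≤1+n i≤x , rest) K-ok)
  where
  open ℕ.≤-Reasoning
  column : List Point
  column = map (suc x ,_) J
  length-column : length column ≡ length J
  length-column = length-map {B = Point} (suc x ,_) J
  disjoint : ∀ {p} → ¬ (p ∈ column × p ∈ K)
  disjoint (p∈J , p∈K) with ∈-map⁻ (suc x ,_) p∈J
  ... | _ , _ , refl = ℕ.<-irrefl refl (proj₁ (All.lookup K-ok p∈K))

-- The flow equation

left below : (ℕ → ℕ → ℤ) → ℕ → ℕ → ℤ
left f zero    y = 0ℤ
left f (suc x) y = f x y
below f x zero    = 0ℤ
below f x (suc y) = f x y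

-- Lattice paths of positive values

-- Lattice paths are recorded by the abscissa g y of their last point in row y.
record Profile (f : ℕ → ℕ → ℤ) (a b : ℕ) : Set where
  field
    g        : ℕ → ℕ
    mono     : ∀ y → g y ≤ g (suc y)
    bounded  : ∀ y → g y ≤ a
    constant : ∀ y → b ≤ y → g y ≡ a
    positive : ∀ y → y ≤ b → 0ℤ ℤ.< f (g y) y

open Profile

-- The same `g` serves, since it already has the value `a` in all rows from `b` on.
stepUp : ∀ {f a b} → 0ℤ ℤ.< f a (suc b) → Profile f a b → Profile f a (suc b)
stepUp {f} {a} {b} 0<f P = record
  { g = g P ; mono = mono P ; bounded = bounded P
  ; constant = λ y b<y → constant P y (ℕ.<⇒≤ b<y)
  ; positive = pos }
  where
  pos : ∀ y → y ≤ suc b → 0ℤ ℤ.< f (g P y) y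
  pos y y≤1+b with ℕ.m≤n⇒m<n∨m≡n y≤1+b
  ... | inj₁ (s≤s y≤b) = positive P y y≤b
  ... | inj₂ refl      = subst (λ x → 0ℤ ℤ.< f x (suc b)) (sym (constant P (suc b) (ℕ.n≤1+n b))) 0<f

module _ {f : ℕ → ℕ → ℤ} {a b : ℕ} (P : Profile f a b) where

  -- A step to the right moves the last point of row `b`; the rows above follow only to keep
  -- `constant` true.
  shifted : ℕ → ℕ
  shifted y with y <? b
  ... | yes _ = g P y
  ... | no _  = suc a

  shifted-< : ∀ {y} → y < b → shifted y ≡ g P y
  shifted-< {y} y<b with y <? b
  ... | yes _  = refl
  ... | no y≮b = contradiction y<b y≮b

  shifted-≥ : ∀ {y} → b ≤ y → shifted y ≡ suc a
  shifted-≥ {y} b≤y with y <? b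
  ... | yes y<b = contradiction y<b (ℕ.≤⇒≯ b≤y)
  ... | no _    = refl

  stepRight : 0ℤ ℤ.< f (suc a) b → Profile f (suc a) b
  stepRight 0<f = record
    { g = shifted ; mono = mono′ ; bounded = bounded′ ; constant = λ _ → shifted-≥ ; positive = positive′ }
    where
    bounded′ : ∀ y → shifted y ≤ suc a
    bounded′ y with y <? b
    ... | yes _ = ℕ.m≤n⇒m≤1+n (bounded P y)
    ... | no _  = ℕ.≤-refl
    mono′ : ∀ y → shifted y ≤ shifted (suc y)
    mono′ y with suc y <? b
    ... | yes 1+y<b = subst (_≤ g P (suc y)) (sym (shifted-< (ℕ.<-trans (ℕ.n<1+n y) 1+y<b))) (mono P y)
    ... | no _      = bounded′ y
    positive′ : ∀ y → y ≤ b → 0ℤ ℤ.< f (shifted y) y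
    positive′ y y≤b with y <? b
    ... | yes _  = positive P y y≤b
    ... | no y≮b rewrite ℕ.≤-antisym y≤b (ℕ.≮⇒≥ y≮b) = 0<f

-- One path read both by rows and by columns. By `separate`, no point of the box is both strictly
-- right of the path and strictly above it, which keeps the two families of sinks apart.
record Path (f : ℕ → ℕ → ℤ) (a b : ℕ) : Set where
  field
    rows     : Profile f a b
    columns  : Profile (flip f) b a
    separate : ∀ x y → x ≤ a → y ≤ b → x ≤ g rows y ⊎ y ≤ g columns x

open Path

extendRight : ∀ {f a b} → 0ℤ ℤ.< f (suc a) b → Path f a b → Path f (suc a) b
extendRight {f} {a} {b} 0<f P = record
  { rows = rows′ ; columns = columns′ ; separate = sep }
  where
  rows′ = stepRight (rows P) 0<f
  columns′ = stepUp 0<f (columns P)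
  sep : ∀ x y → x ≤ suc a → y ≤ b → x ≤ g rows′ y ⊎ y ≤ g columns′ x
  sep x y x≤1+a y≤b with y <? b | ℕ.m≤n⇒m<n∨m≡n x≤1+a
  ... | no _  | _              = inj₁ x≤1+a
  ... | yes _ | inj₁ (s≤s x≤a) = separate P x y x≤a y≤b
  ... | yes _ | inj₂ refl      = inj₂ (subst (y ≤_) (sym (constant columns′ (suc a) ℕ.≤-refl)) y≤b)

transpose : ∀ {f a b} → Path f a b → Path (flip f) b a
transpose P = record
  { rows = columns P ; columns = rows P
  ; separate = λ x y x≤b y≤a → Sum.swap (separate P y x y≤a x≤b) }

extendUp : ∀ {f a b} → 0ℤ ℤ.< f a (suc b) → Path f a b → Path f a (suc b)
extendUp {f} 0<f P = transpose (extendRight {flip f} 0<f (transpose P))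

trivialPath : ∀ {f} → 0ℤ ℤ.< f 0 0 → Path f 0 0
trivialPath {f} 0<f = record
  { rows = trivial f 0<f ; columns = trivial (flip f) 0<f ; separate = λ { _ _ z≤n z≤n → inj₁ z≤n } }
  where
  trivial : ∀ f → 0ℤ ℤ.< f 0 0 → Profile f 0 0
  trivial f 0<f = record
    { g = λ _ → 0 ; mono = λ _ → z≤n ; bounded = λ _ → z≤n ; constant = λ _ _ → refl
    ; positive = λ { _ z≤n → 0<f } }

-- The last nonzero value of a row

-- The default is 0, so `u` may vanish there; `lastNonzero-nonzero` excludes this once some nonzero
-- value is known.
lastNonzero : (ℕ → ℤ) → ℕ → ℕ
lastNonzero u zero    = zero
lastNonzero u (suc n) with u (suc n) ℤ.≟ 0ℤ
... | yes _ = lastNonzero u n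
... | no _  = suc n

module _ (u : ℕ → ℤ) where

  lastNonzero≤ : ∀ n → lastNonzero u n ≤ n
  lastNonzero≤ zero = z≤n
  lastNonzero≤ (suc n) with u (suc n) ℤ.≟ 0ℤ
  ... | yes _ = ℕ.m≤n⇒m≤1+n (lastNonzero≤ n)
  ... | no _  = ℕ.≤-refl

  beyond-lastNonzero : ∀ n → (∀ x → n < x → u x ≡ 0ℤ) → ∀ x → lastNonzero u n < x → u x ≡ 0ℤ
  beyond-lastNonzero zero    zeros x last<x = zeros x last<x
  beyond-lastNonzero (suc n) zeros x last<x with u (suc n) ℤ.≟ 0ℤ
  ... | no _ = zeros x last<x
  ... | yes u≡0 = beyond-lastNonzero n zeros′ x last<x
    where
    zeros′ : ∀ x → n < x → u x ≡ 0ℤ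
    zeros′ x n<x with ℕ.m≤n⇒m<n∨m≡n n<x
    ... | inj₁ 1+n<x = zeros x 1+n<x
    ... | inj₂ refl  = u≡0

  lastNonzero-nonzero : ∀ n x → x ≤ n → u x ≢ 0ℤ → u (lastNonzero u n) ≢ 0ℤ
  lastNonzero-nonzero zero    _ z≤n u≢0 = u≢0
  lastNonzero-nonzero (suc n) x x≤1+n u≢0 with u (suc n) ℤ.≟ 0ℤ | ℕ.m≤n⇒m<n∨m≡n x≤1+n
  ... | no u≢0′ | _              = u≢0′
  ... | yes _   | inj₁ (s≤s x≤n) = lastNonzero-nonzero n x x≤n u≢0
  ... | yes u≡0 | inj₂ refl      = contradiction u≡0 u≢0

-- Propagation of signs along the flow

module Flow (f w : ℕ → ℕ → ℤ) (N : ℕ)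
  (balance : ∀ x y → w x y ℤ.+ f x y ≡ left f x y ℤ.+ below f x y)
  (w≥0 : ∀ x y → 0ℤ ℤ.≤ w (suc x) y)
  (vanish : ∀ x y → N < x → f x y ≡ 0ℤ)
  where

  f≤inflow : ∀ x y → f (suc x) y ℤ.≤ f x y ℤ.+ below f (suc x) y
  f≤inflow x y = begin
    f (suc x) y                 ≡⟨ ℤ.+-identityˡ _ ⟨
    0ℤ ℤ.+ f (suc x) y          ≤⟨ ℤ.+-monoˡ-≤ _ (w≥0 x y) ⟩
    w (suc x) y ℤ.+ f (suc x) y ≡⟨ balance (suc x) y ⟩
    f x y ℤ.+ below f (suc x) y ∎
    where open ℤ.≤-Reasoning

  positive-pred : ∀ x y → 0ℤ ℤ.< f (suc x) y → 0ℤ ℤ.< f x y ⊎ 0ℤ ℤ.< below f (suc x) y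
  positive-pred x y 0<f = 0<i+j⇒0<i⊎0<j _ _ (ℤ.<-≤-trans 0<f (f≤inflow x y))

  -- Where there is no sink, `w` is 0 and the value of `f` equals the inflow, so a negative value
  -- needs a negative inflow.
  negative-pred : ∀ x y → f (suc x) y ℤ.< 0ℤ →
    0ℤ ℤ.< w (suc x) y ⊎ f x y ℤ.< 0ℤ ⊎ below f (suc x) y ℤ.< 0ℤ
  negative-pred x y f<0 with 0ℤ ℤ.<? w (suc x) y
  ... | yes 0<w = inj₁ 0<w
  ... | no 0≮w  = inj₂ (i+j<0⇒i<0⊎j<0 _ _ (subst (ℤ._< 0ℤ) f≡inflow f<0))
    where
    f≡inflow : f (suc x) y ≡ f x y ℤ.+ below f (suc x) y
    f≡inflow = trans (sym (ℤ.+-identityˡ _))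
      (trans (cong (ℤ._+ f (suc x) y) (ℤ.≤-antisym (w≥0 x y) (ℤ.≮⇒≥ 0≮w))) (balance (suc x) y))

  sink-after-row : ∀ x y → 0ℤ ℤ.< f x y → f (suc x) y ≡ 0ℤ → 0ℤ ℤ.≤ below f (suc x) y → 0ℤ ℤ.< w (suc x) y
  sink-after-row x y 0<f f≡0 0≤below = subst (0ℤ ℤ.<_) (sym w≡inflow) (ℤ.+-mono-<-≤ 0<f 0≤below)
    where
    w≡inflow : w (suc x) y ≡ f x y ℤ.+ below f (suc x) y
    w≡inflow = trans (sym (trans (cong (λ z → w (suc x) y ℤ.+ z) f≡0) (ℤ.+-identityʳ _))) (balance (suc x) y)

  -- A negative value propagates to the right forever unless something positive flows in from below.
  negative-absurd : ∀ x y → f x y ℤ.< 0ℤ → (∀ x′ → x < x′ → below f x′ y ℤ.≤ 0ℤ) → ⊥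
  negative-absurd x y f<0 below≤0 =
    ℤ.<⇒≢ (persists (suc N)) (vanish (suc N + x) y (s≤s (ℕ.m≤m+n N x)))
    where
    persists : ∀ k → f (k + x) y ℤ.< 0ℤ
    persists zero    = f<0
    persists (suc k) = ℤ.≤-<-trans (f≤inflow (k + x) y)
      (ℤ.+-mono-<-≤ (persists k) (below≤0 (suc (k + x)) (s≤s (ℕ.m≤n+m x k))))

  bottom-nonneg : ∀ x → 0ℤ ℤ.≤ f x 0
  bottom-nonneg x = ℤ.≮⇒≥ λ f<0 → negative-absurd x 0 f<0 λ _ _ → ℤ.≤-refl

  -- Marking the points to the right of a path

  module RightOf {a b : ℕ} (P : Profile f a b) where

    last : ℕ → ℕ
    last y = lastNonzero (λ x → f x y) N

    f-beyond : ∀ {x y} → last y < x → f x y ≡ 0ℤ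
    f-beyond {x} {y} = beyond-lastNonzero (λ x → f x y) N (λ x → vanish x y) x

    g≤last : ∀ {y} → y ≤ b → g P y ≤ last y
    g≤last {y} y≤b = ℕ.≮⇒≥ λ last<g → ℤ.<⇒≢ (positive P y y≤b) (sym (f-beyond last<g))

    f-last≢0 : ∀ {y} → y ≤ b → f (last y) y ≢ 0ℤ
    f-last≢0 {y} y≤b = lastNonzero-nonzero (λ x → f x y) N (g P y)
      (ℕ.≮⇒≥ λ N<g → ℤ.<⇒≢ (positive P y y≤b) (sym (vanish _ y N<g)))
      (ℤ.<⇒≢ (positive P y y≤b) ∘ sym)

    -- `true` means marked as negative. Points up to the path are unmarked, so column 0 has no run;
    -- the parity beyond the end of each row makes a far column alternate, so that it has as many
    -- runs as possible.
    label : ℕ → ℕ → Bool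
    label zero    y = false
    label (suc x) y with suc x ≤? g P y | ℤ.<-cmp (f (suc x) y) 0ℤ | last y <? suc x
    ... | yes _ | _          | _     = false
    ... | no _  | tri< _ _ _ | _     = true
    ... | no _  | tri> _ _ _ | _     = false
    ... | no _  | tri≈ _ _ _ | yes _ = odd y
    ... | no _  | tri≈ _ _ _ | no _  = label x y

    label-path : ∀ x y → x ≤ g P y → label x y ≡ false
    label-path zero    y _ = refl
    label-path (suc x) y x≤g with suc x ≤? g P y
    ... | yes _  = refl
    ... | no x≰g = contradiction x≤g x≰g

    label-positive : ∀ x y → 0ℤ ℤ.< f x y → label x y ≡ false
    label-positive zero    y _ = refl
    label-positive (suc x) y 0<f with suc x ≤? g P y | ℤ.<-cmp (f (suc x) y) 0ℤ | last y <? suc x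
    ... | yes _ | _            | _ = refl
    ... | no _  | tri< _ _ f≯0 | _ = contradiction 0<f f≯0
    ... | no _  | tri> _ _ _   | _ = refl
    ... | no _  | tri≈ _ _ f≯0 | _ = contradiction 0<f f≯0

    label-negative : ∀ x y → g P y < x → f x y ℤ.< 0ℤ → label x y ≡ true
    label-negative (suc x) y g<x f<0 with suc x ≤? g P y | ℤ.<-cmp (f (suc x) y) 0ℤ | last y <? suc x
    ... | yes x≤g | _            | _ = contradiction g<x (ℕ.≤⇒≯ x≤g)
    ... | no _    | tri< _ _ _   | _ = refl
    ... | no _    | tri> f≮0 _ _ | _ = contradiction f<0 f≮0
    ... | no _    | tri≈ f≮0 _ _ | _ = contradiction f<0 f≮0

    label-beyond : ∀ x y → y ≤ b → last y < x → label x y ≡ odd y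
    label-beyond (suc x) y y≤b last<x with suc x ≤? g P y | ℤ.<-cmp (f (suc x) y) 0ℤ | last y <? suc x
    ... | yes x≤g | _            | _          = contradiction (ℕ.≤-trans x≤g (g≤last y≤b)) (ℕ.<⇒≱ last<x)
    ... | no _    | tri< _ f≢0 _ | _          = contradiction (f-beyond last<x) f≢0
    ... | no _    | tri> _ f≢0 _ | _          = contradiction (f-beyond last<x) f≢0
    ... | no _    | tri≈ _ _ _   | yes _      = refl
    ... | no _    | tri≈ _ _ _   | no last≮x  = contradiction last<x last≮x

    label-copy : ∀ x y → g P y < suc x → f (suc x) y ≡ 0ℤ → suc x ≤ last y → label (suc x) y ≡ label x y
    label-copy x y g<x f≡0 x≤last with suc x ≤? g P y | ℤ.<-cmp (f (suc x) y) 0ℤ | last y <? suc x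
    ... | yes x≤g | _            | _          = contradiction g<x (ℕ.≤⇒≯ x≤g)
    ... | no _    | tri< _ f≢0 _ | _          = contradiction f≡0 f≢0
    ... | no _    | tri> _ f≢0 _ | _          = contradiction f≡0 f≢0
    ... | no _    | tri≈ _ _ _   | yes last<x = contradiction x≤last (ℕ.<⇒≱ last<x)
    ... | no _    | tri≈ _ _ _   | no _       = refl

    label-bottom : ∀ x → label x 0 ≡ false
    label-bottom zero = refl
    label-bottom (suc x) with suc x ≤? g P 0 | ℤ.<-cmp (f (suc x) 0) 0ℤ | last 0 <? suc x
    ... | yes _ | _            | _     = refl
    ... | no _  | tri< f<0 _ _ | _     = contradiction f<0 (ℤ.≤⇒≯ (bottom-nonneg (suc x)))
    ... | no _  | tri> _ _ _   | _     = refl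
    ... | no _  | tri≈ _ _ _   | yes _ = refl
    ... | no _  | tri≈ _ _ _   | no _  = label-bottom x

    -- The local rule required by `runs-columns`. Up to the path nothing is marked; further right,
    -- signs are inherited through the flow equation and zeros copy their left neighbour, so the
    -- delicate place is the first zero after the end of a row.
    label-pred : ∀ x y → suc y ≤ b →
      (label (suc x) (suc y) ≡ true × 0ℤ ℤ.< w (suc x) (suc y)) ⊎
      label (suc x) (suc y) ≡ label x (suc y) ⊎ label (suc x) (suc y) ≡ label (suc x) y
    label-pred x y y<b = on-either-side (suc x ≤? g P (suc y))
      where
      Goal : Set
      Goal = (label (suc x) (suc y) ≡ true × 0ℤ ℤ.< w (suc x) (suc y)) ⊎
        label (suc x) (suc y) ≡ label x (suc y) ⊎ label (suc x) (suc y) ≡ label (suc x) y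

      on-either-side : Dec (suc x ≤ g P (suc y)) → Goal
      on-either-side (yes x≤g) = inj₂ (inj₁ (trans (label-path (suc x) (suc y) x≤g)
                                      (sym (label-path x (suc y) (ℕ.<⇒≤ x≤g)))))
      on-either-side (no x≰g) = right-of-path (ℤ.<-cmp (f (suc x) (suc y)) 0ℤ)
        where
        g<1+x : g P (suc y) < suc x
        g<1+x = ℕ.≰⇒> x≰g

        -- The left neighbour could be the last path point of its row, but there `f` is positive.
        g<x : f x (suc y) ℤ.< 0ℤ → g P (suc y) < x
        g<x f<0 with ℕ.m≤n⇒m<n∨m≡n (ℕ.≤-pred g<1+x)
        ... | inj₁ g<x  = g<x
        ... | inj₂ refl = contradiction f<0 (ℤ.<-asym (positive P (suc y) y<b))

        left-negative : f x (suc y) ℤ.< 0ℤ → label x (suc y) ≡ true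
        left-negative f<0 = label-negative x (suc y) (g<x f<0) f<0

        -- The path never moves left as it goes up, so the lower neighbour is also to its right.
        below-negative : f (suc x) y ℤ.< 0ℤ → label (suc x) y ≡ true
        below-negative = label-negative (suc x) y (ℕ.≤-<-trans (mono P y) g<1+x)

        -- The end of a row: the signs of f x (suc y) and f (suc x) y are opposite,
        -- or there is a sink and both labels are allowed.
        row-end : f (suc x) (suc y) ≡ 0ℤ → x ≡ last (suc y) → ∀ t → label (suc x) (suc y) ≡ t → Goal
        row-end f≡0 x≡last t eq with ℤ.<-cmp (f x (suc y)) 0ℤ
        ... | tri≈ _ f≡0′ _ = contradiction (subst (λ z → f z (suc y) ≡ 0ℤ) x≡last f≡0′) (f-last≢0 y<b)
        row-end f≡0 x≡last true eq | tri< f<0 _ _ = inj₂ (inj₁ (trans eq (sym (left-negative f<0))))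
        row-end f≡0 x≡last false eq | tri> _ _ 0<f = inj₂ (inj₁ (trans eq (sym (label-positive x (suc y) 0<f))))
        row-end f≡0 x≡last false eq | tri< f<0 _ _ = inj₂ (inj₂ (trans eq (sym (label-positive (suc x) y 0<below))))
          where
          0<below : 0ℤ ℤ.< f (suc x) y
          0<below = ℤ.≰⇒> λ below≤0 → ℤ.<-irrefl refl (ℤ.≤-<-trans
            (subst (ℤ._≤ f x (suc y) ℤ.+ f (suc x) y) f≡0 (f≤inflow x (suc y)))
            (ℤ.+-mono-<-≤ f<0 below≤0))
        row-end f≡0 x≡last true eq | tri> _ _ 0<f with f (suc x) y ℤ.<? 0ℤ
        ... | yes below<0 = inj₂ (inj₂ (trans eq (sym (below-negative below<0))))
        ... | no below≮0  = inj₁ (eq , sink-after-row x (suc y) 0<f f≡0 (ℤ.≮⇒≥ below≮0))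

        right-of-path : Tri (f (suc x) (suc y) ℤ.< 0ℤ) (f (suc x) (suc y) ≡ 0ℤ) (0ℤ ℤ.< f (suc x) (suc y)) → Goal
        right-of-path (tri< f<0 _ _) with negative-pred x (suc y) f<0
        ... | inj₁ 0<w              = inj₁ (label-negative (suc x) (suc y) g<1+x f<0 , 0<w)
        ... | inj₂ (inj₁ left<0)    = inj₂ (inj₁ (trans (label-negative (suc x) (suc y) g<1+x f<0) (sym (left-negative left<0))))
        ... | inj₂ (inj₂ below<0)   = inj₂ (inj₂ (trans (label-negative (suc x) (suc y) g<1+x f<0) (sym (below-negative below<0))))
        right-of-path (tri> _ _ 0<f) with positive-pred x (suc y) 0<f
        ... | inj₁ 0<left  = inj₂ (inj₁ (trans (label-positive (suc x) (suc y) 0<f) (sym (label-positive x (suc y) 0<left))))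
        ... | inj₂ 0<below = inj₂ (inj₂ (trans (label-positive (suc x) (suc y) 0<f) (sym (label-positive (suc x) y 0<below))))
        right-of-path (tri≈ _ f≡0 _) with ℕ.<-cmp x (last (suc y))
        ... | tri< x<last _ _ = inj₂ (inj₁ (label-copy x (suc y) g<1+x f≡0 x<last))
        ... | tri≈ _ x≡last _ = row-end f≡0 x≡last _ refl
        ... | tri> _ _ last<x = inj₂ (inj₁ (trans (label-beyond (suc x) (suc y) y<b (ℕ.m≤n⇒m≤1+n last<x))
                                                  (sym (label-beyond x (suc y) y<b last<x))))

    -- The last inequality says length K ≥ 1 + ⌈b/2⌉.
    sinks : ∃[ K ] Unique K × All (λ (x , y) → 0ℤ ℤ.< w x y × y ≤ b × g P y < x) K × 2 + b ≤ 2 * length K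
    sinks with runs-columns (λ x y → 0ℤ ℤ.< w x y) label b (λ _ → refl) label-bottom label-pred (suc N)
    -- Column `suc N` is beyond the last nonzero value of every row, so its marks are the parities.
    ... | K , K! , runs≤ , K-ok =
        -- The sink at the end of row 0 is additional, as all points of `K` have positive ordinate.
        (suc (last 0) , 0) ∷ K
      , All.map (λ { (_ , (() , _) , _) refl }) K-ok ∷ K!
      , (bottom-sink , z≤n , s≤s (g≤last z≤n)) ∷ All.map relax K-ok
      , (begin
          2 + b                     ≤⟨ ℕ.+-monoʳ-≤ 2 (runs-odd b) ⟩
          2 + 2 * runs odd b        ≡⟨ cong (λ r → 2 + 2 * r) (runs-cong b λ y y≤b →
                                         label-beyond (suc N) y y≤b (s≤s (lastNonzero≤ (λ x → f x y) N))) ⟨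
          2 + 2 * runs (label (suc N)) b ≤⟨ ℕ.+-monoʳ-≤ 2 (ℕ.*-monoʳ-≤ 2 runs≤) ⟩
          2 + 2 * length K          ≡⟨ ℕ.*-suc 2 (length K) ⟨
          2 * suc (length K)        ∎)
      where
      open ℕ.≤-Reasoning
      bottom-sink : 0ℤ ℤ.< w (suc (last 0)) 0
      bottom-sink = sink-after-row (last 0) 0
        (ℤ.≤∧≢⇒< (bottom-nonneg (last 0)) (f-last≢0 z≤n ∘ sym)) (f-beyond ℕ.≤-refl) ℤ.≤-refl
      relax : ∀ {p} → _ → 0ℤ ℤ.< w (proj₁ p) (proj₂ p) × proj₂ p ≤ b × g P (proj₂ p) < proj₁ p
      relax {x , y} (_ , (_ , y≤b) , marked , 0<w) =
        0<w , y≤b , ℕ.≰⇒> λ x≤g → contradiction (trans (sym marked) (label-path x y x≤g)) λ()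

-- Degree bound from both sides of a path

left-flip : ∀ f x y → left (flip f) x y ≡ below f y x
left-flip f zero    y = refl
left-flip f (suc x) y = refl

below-flip : ∀ f x y → below (flip f) x y ≡ left f y x
below-flip f x zero    = refl
below-flip f x (suc y) = refl

module DegreeBound (f w : ℕ → ℕ → ℤ) (N : ℕ)
  (balance : ∀ x y → w x y ℤ.+ f x y ≡ left f x y ℤ.+ below f x y)
  (w≥0 : ∀ x y → (x , y) ≢ (0 , 0) → 0ℤ ℤ.≤ w x y)
  (vanishˣ : ∀ x y → N < x → f x y ≡ 0ℤ)
  (vanishʸ : ∀ x y → N < y → f x y ≡ 0ℤ)
  where

  module Rightward = Flow f w N balance (λ x y → w≥0 (suc x) y λ ()) vanishˣ
  -- Reflection in the diagonal turns the sinks above a path into sinks to its right.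
  module Upward = Flow (flip f) (flip w) N
    (λ x y → trans (balance y x) (trans (ℤ.+-comm (left f y x) _)
      (sym (cong₂ ℤ._+_ (left-flip f x y) (below-flip f x y)))))
    (λ x y → w≥0 y (suc x) λ ()) (λ x y → vanishʸ y x)

  positive⇒path : ∀ a b → 0ℤ ℤ.< f a b → Path f a b
  positive⇒path zero zero 0<f = trivialPath 0<f
  -- In column 0 nothing enters from the left, so positivity can only be traced downwards.
  positive⇒path zero (suc b) 0<f with Upward.positive-pred b zero 0<f
  ... | inj₁ 0<f′ = extendUp 0<f (positive⇒path zero b 0<f′)
  ... | inj₂ 0<0  = contradiction 0<0 (ℤ.<-irrefl refl)
  positive⇒path (suc a) b 0<f with Rightward.positive-pred a b 0<f
  positive⇒path (suc a) b       0<f | inj₁ 0<f′ = extendRight 0<f (positive⇒path a b 0<f′)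
  positive⇒path (suc a) zero    0<f | inj₂ 0<0  = contradiction 0<0 (ℤ.<-irrefl refl)
  positive⇒path (suc a) (suc b) 0<f | inj₂ 0<f′ = extendUp 0<f (positive⇒path (suc a) b 0<f′)

  -- Each step of the backward trace lowers the degree by one, so `k` steps reach degree `e`.
  positive-at-degree : ∀ e k a b → a + b ≡ k + e → 0ℤ ℤ.< f a b → ∃[ a′ ] ∃[ b′ ] a′ + b′ ≡ e × 0ℤ ℤ.< f a′ b′
  positive-at-degree e zero a b eq 0<f = a , b , eq , 0<f
  positive-at-degree e (suc k) zero (suc b) eq 0<f with Upward.positive-pred b zero 0<f
  ... | inj₁ 0<f′ = positive-at-degree e k zero b (ℕ.suc-injective eq) 0<f′
  ... | inj₂ 0<0  = contradiction 0<0 (ℤ.<-irrefl refl)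
  positive-at-degree e (suc k) (suc a) b eq 0<f with Rightward.positive-pred a b 0<f
  positive-at-degree e (suc k) (suc a) b       eq 0<f | inj₁ 0<f′ = positive-at-degree e k a b (ℕ.suc-injective eq) 0<f′
  positive-at-degree e (suc k) (suc a) zero    eq 0<f | inj₂ 0<0  = contradiction 0<0 (ℤ.<-irrefl refl)
  positive-at-degree e (suc k) (suc a) (suc b) eq 0<f | inj₂ 0<f′ =
    positive-at-degree e k (suc a) b (ℕ.suc-injective (trans (sym (ℕ.+-suc (suc a) b)) eq)) 0<f′

  w-origin≤0 : w 0 0 ℤ.≤ 0ℤ
  w-origin≤0 = ℤ.≮⇒≥ λ 0<w →
    ℤ.<⇒≢ (ℤ.+-mono-<-≤ 0<w (Rightward.bottom-nonneg 0)) (sym (balance 0 0))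

  -- If `f` had no positive value in degree `e`, it would have none in higher degrees either. The
  -- inflow at the sink would then be at most 0, `f` would be negative there, and this would persist
  -- to the right forever.
  sink⇒positive : ∀ e x y → x + y ≡ suc e → 0ℤ ℤ.< w x y → ∃[ a ] ∃[ b ] a + b ≡ e × 0ℤ ℤ.< f a b
  -- The points of degree `e` are `(a , e ∸ a)` with `a < suc e`, so a finite search decides.
  sink⇒positive e x y deg≡ 0<w with ℕ.anyUpTo? (λ a → 0ℤ ℤ.<? f a (e ∸ a)) (suc e)
  ... | yes (a , s≤s a≤e , 0<f) = a , e ∸ a , ℕ.m+[n∸m]≡n a≤e , 0<f
  ... | no none = ⊥-elim (Rightward.negative-absurd x y f<0 λ x′ x<x′ →
        below≤0 x′ y (subst (_≤ x′ + y) deg≡ (ℕ.+-monoˡ-≤ y (ℕ.<⇒≤ x<x′))))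
    where
    f≤0 : ∀ a b → e ≤ a + b → f a b ℤ.≤ 0ℤ
    f≤0 a b e≤a+b = ℤ.≮⇒≥ λ 0<f →
      let a′ , b′ , a′+b′≡e , 0<f′ = positive-at-degree e (a + b ∸ e) a b (sym (ℕ.m∸n+n≡m e≤a+b)) 0<f
      in none (a′ , s≤s (ℕ.m+n≤o⇒m≤o a′ (ℕ.≤-reflexive a′+b′≡e))
             , subst (λ b → 0ℤ ℤ.< f a′ b) (trans (sym (ℕ.m+n∸m≡n a′ b′)) (cong (_∸ a′) a′+b′≡e)) 0<f′)

    left≤0 : ∀ a b → suc e ≤ a + b → left f a b ℤ.≤ 0ℤ
    left≤0 zero    b _         = ℤ.≤-refl
    left≤0 (suc a) b (s≤s e≤) = f≤0 a b e≤

    below≤0 : ∀ a b → suc e ≤ a + b → below f a b ℤ.≤ 0ℤ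
    below≤0 a zero    _  = ℤ.≤-refl
    below≤0 a (suc b) e< = f≤0 a b (ℕ.≤-pred (subst (suc e ≤_) (ℕ.+-suc a b) e<))

    f<0 : f x y ℤ.< 0ℤ
    f<0 = ℤ.≰⇒> λ 0≤f → ℤ.<⇒≱ (ℤ.+-mono-<-≤ 0<w 0≤f) (subst (ℤ._≤ 0ℤ) (sym (balance x y))
      (ℤ.+-mono-≤ (left≤0 x y (ℕ.≤-reflexive (sym deg≡))) (below≤0 x y (ℕ.≤-reflexive (sym deg≡)))))

  module _ (L : List Point) (sink∈L : ∀ x y → 0ℤ ℤ.< w x y → (x , y) ∈ L) where

    path-bound : ∀ {a b} → Path f a b → 4 + (a + b) ≤ 2 * length L
    path-bound {a} {b} P
      with Rightward.RightOf.sinks (rows P) | Upward.RightOf.sinks (columns P)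
    ... | R , R! , R-ok , R-long | U , U! , U-ok , U-long = begin
      4 + (a + b)                   ≡⟨ regroup a b ⟩
      (2 + b) + (2 + a)             ≤⟨ ℕ.+-mono-≤ R-long U-long ⟩
      2 * length R + 2 * length U   ≡⟨ ℕ.*-distribˡ-+ 2 (length R) (length U) ⟨
      2 * (length R + length U)     ≡⟨ cong (λ k → 2 * (length R + k)) (length-map swap U) ⟨
      2 * (length R + length U′)    ≡⟨ cong (2 *_) (length-++ R) ⟨
      2 * length (R ++ U′)          ≤⟨ ℕ.*-monoʳ-≤ 2 (Unique-⊆⇒length≤ (Unique.++⁺ R! U′! disjoint) ⊆L) ⟩
      2 * length L                  ∎
      where
      open ℕ.≤-Reasoning
      regroup : ∀ a b → 4 + (a + b) ≡ (2 + b) + (2 + a)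
      regroup = solve-∀

      U′ : List Point
      U′ = map swap U

      U′! : Unique U′
      U′! = Unique.map⁺ (cong swap) U!

      U′-ok : ∀ {x y} → (x , y) ∈ U′ → 0ℤ ℤ.< w x y × x ≤ a × g (columns P) x < y
      U′-ok p∈U′ with ∈-map⁻ swap p∈U′
      ... | _ , p∈U , refl = All.lookup U-ok p∈U

      -- A common point has `y ≤ b` from `R` and `x ≤ a` from `U′`, so it lies in the box that
      -- `separate` covers.
      disjoint : ∀ {p} → ¬ (p ∈ R × p ∈ U′)
      disjoint {x , y} (p∈R , p∈U′) with All.lookup R-ok p∈R | U′-ok p∈U′
      ... | _ , y≤b , g<x | _ , x≤a , h<y with separate P x y x≤a y≤b
      ... | inj₁ x≤g = ℕ.<⇒≱ g<x x≤g
      ... | inj₂ y≤h = ℕ.<⇒≱ h<y y≤h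

      ⊆L : ∀ {p} → p ∈ R ++ U′ → p ∈ L
      ⊆L {x , y} p∈ with ∈-++⁻ R p∈
      ... | inj₁ p∈R  = sink∈L x y (proj₁ (All.lookup R-ok p∈R))
      ... | inj₂ p∈U′ = sink∈L x y (proj₁ (U′-ok p∈U′))

    degree-bound : ∀ x y → 0ℤ ℤ.< w x y → 3 + (x + y) ≤ 2 * length L
    degree-bound x y 0<w with x + y in deg≡
    -- The path ends one degree below the sink, and `4 + e` is `3 + suc e`.
    ... | suc e = let a , b , a+b≡e , 0<f = sink⇒positive e x y deg≡ 0<w in
      subst (λ e → 4 + e ≤ 2 * length L) a+b≡e (path-bound (positive⇒path a b 0<f))
    -- Degree 0 leaves only the origin, which is never a sink.
    degree-bound zero zero 0<w | zero = contradiction 0<w (ℤ.≤⇒≯ w-origin≤0)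

-- From move sequences to flows

-- Inflow minus outflow: the change of a configuration when `f x y` is the net number of splittings
-- at `(x , y)`.
divergence : (ℕ → ℕ → ℤ) → ℕ → ℕ → ℤ
divergence f x y = (left f x y ℤ.+ below f x y) - f x y

infixl 6 _⊕_
_⊕_ : (f h : ℕ → ℕ → ℤ) → ℕ → ℕ → ℤ
(f ⊕ h) x y = f x y ℤ.+ h x y

divergence-⊕ : ∀ f h x y → divergence (f ⊕ h) x y ≡ divergence f x y ℤ.+ divergence h x y
divergence-⊕ f h x y = trans
  (cong₂ (λ i j → (i ℤ.+ j) - (f x y ℤ.+ h x y)) (left-⊕ x) (below-⊕ y))
  (interchange (left f x y) (left h x y) (below f x y) (below h x y) (f x y) (h x y))
  where
  left-⊕ : ∀ x → left (f ⊕ h) x y ≡ left f x y ℤ.+ left h x y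
  left-⊕ zero    = refl
  left-⊕ (suc x) = refl
  below-⊕ : ∀ y → below (f ⊕ h) x y ≡ below f x y ℤ.+ below h x y
  below-⊕ zero    = refl
  below-⊕ (suc y) = refl
  interchange : ∀ a b c d e k →
    ((a ℤ.+ b) ℤ.+ (c ℤ.+ d)) - (e ℤ.+ k) ≡ ((a ℤ.+ c) - e) ℤ.+ ((b ℤ.+ d) - k)
  interchange = ℤ-Solver.solve-∀

divergence-neg : ∀ f x y → divergence (λ x y → ℤ.- f x y) x y ≡ ℤ.- divergence f x y
divergence-neg f x y = trans (cong₂ (λ i j → (i ℤ.+ j) - (ℤ.- f x y)) (left-neg x) (below-neg y))
  (distribute (left f x y) (below f x y) (f x y))
  where
  left-neg : ∀ x → left (λ x y → ℤ.- f x y) x y ≡ ℤ.- left f x y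
  left-neg zero    = refl
  left-neg (suc x) = refl
  below-neg : ∀ y → below (λ x y → ℤ.- f x y) x y ≡ ℤ.- below f x y
  below-neg zero    = refl
  below-neg (suc y) = refl
  distribute : ∀ a b c → (ℤ.- a ℤ.+ ℤ.- b) - (ℤ.- c) ≡ ℤ.- ((a ℤ.+ b) - c)
  distribute = ℤ-Solver.solve-∀

moveFlow : Move → ℕ → ℕ → ℤ
moveFlow (true  , p) x y = ind p (x , y)
moveFlow (false , p) x y = ℤ.- ind p (x , y)

flow : List Move → ℕ → ℕ → ℤ
flow []       = λ _ _ → 0ℤ
flow (m ∷ ms) = moveFlow m ⊕ flow ms

-- The `does` fields of the two decisions agree by computation, so the proof passes through them.
⌊suc≟suc⌋ : ∀ m n → ⌊ suc m ℕ.≟ suc n ⌋ ≡ ⌊ m ℕ.≟ n ⌋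
⌊suc≟suc⌋ m n = trans (isYes≗does (suc m ℕ.≟ suc n)) (sym (isYes≗does (m ℕ.≟ n)))

splitDelta-divergence : ∀ p x y → splitDelta p (x , y) ≡ divergence (λ x y → ind p (x , y)) x y
splitDelta-divergence p@(a , b) x y = trans
  (cong₂ (λ i j → (ℤ.- ind p (x , y) ℤ.+ i) ℤ.+ j) (ind-left x) (ind-below y))
  (reorder (ind p (x , y)) _ _)
  where
  ind-left : ∀ x → ind (suc a , b) (x , y) ≡ left (λ x y → ind p (x , y)) x y
  ind-left zero    = refl
  ind-left (suc x) = cong (λ c → if c ∧ ⌊ b ℕ.≟ y ⌋ then 1ℤ else 0ℤ) (⌊suc≟suc⌋ a x)
  ind-below : ∀ y → ind (a , suc b) (x , y) ≡ below (λ x y → ind p (x , y)) x y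
  ind-below zero    = cong (λ c → if c then 1ℤ else 0ℤ) (∧-zeroʳ _)
  ind-below (suc y) = cong (λ c → if ⌊ a ℕ.≟ x ⌋ ∧ c then 1ℤ else 0ℤ) (⌊suc≟suc⌋ b y)
  reorder : ∀ k i j → (ℤ.- k ℤ.+ i) ℤ.+ j ≡ (i ℤ.+ j) - k
  reorder = ℤ-Solver.solve-∀

applyMove-divergence : ∀ m u x y → applyMove m u (x , y) ≡ u (x , y) ℤ.+ divergence (moveFlow m) x y
applyMove-divergence (true  , p) u x y = cong (λ z → u (x , y) ℤ.+ z) (splitDelta-divergence p x y)
applyMove-divergence (false , p) u x y = cong (λ z → u (x , y) ℤ.+ z)
  (trans (cong ℤ.-_ (splitDelta-divergence p x y)) (sym (divergence-neg (λ x y → ind p (x , y)) x y)))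

applyMoves-divergence : ∀ ms u x y → applyMoves ms u (x , y) ≡ u (x , y) ℤ.+ divergence (flow ms) x y
-- The case split on both coordinates lets `left` and `below` reduce.
applyMoves-divergence [] u zero    zero    = sym (ℤ.+-identityʳ _)
applyMoves-divergence [] u zero    (suc y) = sym (ℤ.+-identityʳ _)
applyMoves-divergence [] u (suc x) zero    = sym (ℤ.+-identityʳ _)
applyMoves-divergence [] u (suc x) (suc y) = sym (ℤ.+-identityʳ _)
applyMoves-divergence (m ∷ ms) u x y = begin
  applyMoves ms (applyMove m u) (x , y)
    ≡⟨ applyMoves-divergence ms (applyMove m u) x y ⟩
  applyMove m u (x , y) ℤ.+ divergence (flow ms) x y
    ≡⟨ cong (ℤ._+ divergence (flow ms) x y) (applyMove-divergence m u x y) ⟩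
  u (x , y) ℤ.+ divergence (moveFlow m) x y ℤ.+ divergence (flow ms) x y
    ≡⟨ ℤ.+-assoc (u (x , y)) _ _ ⟩
  u (x , y) ℤ.+ (divergence (moveFlow m) x y ℤ.+ divergence (flow ms) x y)
    ≡⟨ cong (λ z → u (x , y) ℤ.+ z) (divergence-⊕ (moveFlow m) (flow ms) x y) ⟨
  u (x , y) ℤ.+ divergence (flow (m ∷ ms)) x y ∎
  where open ≡-Reasoning

-- A crude bound on the coordinates of all points used by the moves; it serves as `N`.
totalDegree : List Move → ℕ
totalDegree []             = 0
totalDegree ((_ , p) ∷ ms) = deg p + totalDegree ms

ind-≢ : ∀ p q → p ≢ q → ind p q ≡ 0ℤ
ind-≢ (a , b) (x , y) p≢q with a ℕ.≟ x | b ℕ.≟ y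
... | no _     | _        = refl
... | yes _    | no _     = refl
... | yes refl | yes refl = contradiction refl p≢q

-- Taking `coord` as either projection covers far columns and far rows at once.
flow-vanishes : ∀ ms (coord : Point → ℕ) → (∀ p → coord p ≤ deg p) →
  ∀ x y → totalDegree ms < coord (x , y) → flow ms x y ≡ 0ℤ
flow-vanishes [] coord coord≤deg x y _ = refl
flow-vanishes (m@(s , p) ∷ ms) coord coord≤deg x y total< = cong₂ ℤ._+_ (move≡0 s)
  (flow-vanishes ms coord coord≤deg x y (ℕ.≤-<-trans (ℕ.m≤n+m _ (deg p)) total<))
  where
  p≢q : p ≢ (x , y)
  p≢q refl = ℕ.<-irrefl refl (ℕ.≤-<-trans (ℕ.≤-trans (coord≤deg p) (ℕ.m≤m+n _ _)) total<)
  move≡0 : ∀ s → moveFlow (s , p) x y ≡ 0ℤ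
  move≡0 true  = ind-≢ p (x , y) p≢q
  move≡0 false = cong ℤ.-_ (ind-≢ p (x , y) p≢q)

outcome-degree-bound : ∀ {d w} (L : List Point) → Outcome d w → Valid w → (∀ q → 0ℤ ℤ.< w q → q ∈ L) →
  ∀ q → 0ℤ ℤ.< w q → 3 + deg q ≤ 2 * length L
outcome-degree-bound {w = w} L (ms , _ , reach) valid pos⊆L (x , y) =
  DegreeBound.degree-bound (flow ms) (λ x y → w (x , y)) (totalDegree ms)
    balance
    (λ x y q≢0 → ℤ.≮⇒≥ λ w<0 → q≢0 (valid (x , y) w<0))
    (flow-vanishes ms proj₁ (λ (a , b) → ℕ.m≤m+n a b))
    (flow-vanishes ms proj₂ (λ (a , b) → ℕ.m≤n+m b a))
    L (λ x y → pos⊆L (x , y)) x y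
  where
  balance : ∀ x y → w (x , y) ℤ.+ flow ms x y ≡ left (flow ms) x y ℤ.+ below (flow ms) x y
  balance x y = trans
    (cong (ℤ._+ flow ms x y) (trans (sym (reach (x , y))) (applyMoves-divergence ms zeroConfig x y)))
    (cancel _ (flow ms x y))
    where
    cancel : ∀ i k → 0ℤ ℤ.+ (i - k) ℤ.+ k ≡ i
    cancel = ℤ-Solver.solve-∀

theorem3p6 : (d : ℕ∞) (n : ℕ) (w : Config) → n ≤ 4 → Outcome d w → Valid w → PosSuppSize w (suc n) → DegLE w ((+ (2 * n)) - 1ℤ)
theorem3p6 d n w _ outcome valid (L@(p ∷ _) , _ , pos⇔∈L , length≡) q w≢0 = strict⇒pred (sign (ℤ.<-cmp (w q) 0ℤ))
  where
  positive-bound : ∀ q → 0ℤ ℤ.< w q → suc (deg q) ≤ 2 * n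
  -- As `2 * suc n` is `2 + 2 * n`, two successors cancel from `3 + deg q`.
  positive-bound q 0<w = ℕ.≤-pred (ℕ.≤-pred (subst (3 + deg q ≤_)
    (trans (cong (2 *_) length≡) (ℕ.*-suc 2 n))
    (outcome-degree-bound L outcome valid (λ q → Equivalence.to (pos⇔∈L q)) q 0<w)))

  sign : Tri (w q ℤ.< 0ℤ) (w q ≡ 0ℤ) (0ℤ ℤ.< w q) → suc (deg q) ≤ 2 * n
  sign (tri≈ _ w≡0 _) = contradiction w≡0 w≢0
  sign (tri> _ _ 0<w) = positive-bound q 0<w
  -- A negative entry sits at the origin, of degree 0; the sink `p` shows that `2 * n` is at least
  -- 1.
  sign (tri< w<0 _ _) = subst (λ q → suc (deg q) ≤ 2 * n) (sym (valid q w<0))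
    (ℕ.≤-trans (s≤s z≤n) (positive-bound p (Equivalence.from (pos⇔∈L p) (here refl))))

  strict⇒pred : ∀ {k m} → suc k ≤ m → + k ℤ.≤ + m - 1ℤ
  strict⇒pred (s≤s k≤m) = ℤ.+≤+ k≤m
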